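{- Under the memory model $\mathsf{StrCOH}$ (Strong Coherence, defined in the context), with the just set consisting of all program commands and the internal memory transitions $\mathsf{prop}$, the Ticket lock algorithm is starvation free for any number of threads: for every $n\ge1$ and every $k\in\{1,\dots,n\}$, the combined transition system of program $\mathtt{Ticket}$ with $n$ threads and $\mathsf{StrCOH}$ fairly satisfies $\Box(\mathsf{at}\_\mathtt{l}_{k0}\rightarrow\Diamond\,\mathsf{at}\_\mathtt{l}_{k4})$.
   Context: **Program Ticket.** Shared locations $\mathtt{next},\mathtt{srv}$; threads $\mathtt{T}_1,\dots,\mathtt{T}_n$; thread $\mathtt{T}_k$ has registers $\mathtt{nxt}[k],\mathtt{s}[k]$ and executes: $\mathtt{l}_{k0}:\mathtt{nxt}[k]:=\mathbf{FADD}(\mathtt{next},1)$; $\mathtt{l}_{k1}:$ while $\mathtt{s}[k]\ne\mathtt{nxt}[k]$ do $\mathtt{l}_{k2}:\mathtt{s}[k]:=\mathbf{LOAD}(\mathtt{srv})$; $\mathtt{l}_{k3}:\mathbf{FADD}(\mathtt{srv},1)$ (read value discarded); $\mathtt{l}_{k4}:$ (end). **Program semantics.** $\mathsf{Tid}$ consists of the program's threads and an initializing thread $\mathtt{T}_0$ (with no code). Program states consist of the remaining program, a register store $\gamma$ (initially all $0$) and a map $pc$ from threads to positions (initially first positions). A step of thread $\tau$ at position $l=pc(\tau)$ has label $(\tau,\ell,l)$: $a:=\mathbf{LOAD}(x)$ has $\ell=\mathtt{R}(x,v)$ and sets $a$ to $v$; $a:=\mathbf{FADD}(x,e)$ has $\ell=\mathtt{RMW}(x,v,v+\gamma(e))$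 and sets $a$ to $v$ ($v$ arbitrary locally); the while test has $\ell=\varepsilon$ and moves to the position of the branch determined by the test (after the while body, control returns to the test). $pc(\tau)$ is updated to the next position. **Memory model StrCOH.** A view is a map from locations to $\mathbb{N}$ (timestamps). A state is $q=\langle M,\nu\rangle$ with $M$ a set of messages $\langle x:v@t,\tau,V\rangle$ (location, value, timestamp, writing thread, view) and $\nu$ assigning a view to each thread. Initially $M_0=\{\langle x:0@0,\mathtt{T}_0,V_0\rangle\mid x\text{ a location}\}$, $V_0\equiv0$, $\nu_0(\tau)=V_0$ for all $\tau$. Transitions: - Read: $q\xrightarrow{\tau,\mathtt{R}(x,v)}q$ if some $\langle x:v@t,\cdot,\cdot\rangle\in M$ has $\nu(\tau)(x)=t$. - Write: if no message on $x$ in $M$ has timestamp $t$ and $\nu(\tau)(x)<t$, then with $V=\nu(\tau)[x\mapsto t]$: $q\xrightarrow{\tau,\mathtt{W}(x,v)}\langle M\cup\{\langle x:v@t,\tau,V\rangle\},\nu[\tau\mapsto V]\rangle$. - RMW: $q\xrightarrow{\tau,\mathtt{RMW}(x,v_r,v_w)}q'$ if $q\xrightarrow{\tau,\mathtt{R}(x,v_r)}q\xrightarrow{\tau,\mathtt{W}(x,v_w)}q'$ and $q'.\nu(\tau)(x)=q.\nu(\tau)(x)+1$. - Propagate (internal, label $\mathsf{prop}$): for a message $m=\langle x:v@t,\cdot,V\rangle\in M$ and a thread $\tau$ with $\nu(\tau)(x)<t$: $q\xrightarrow{\mathsf{prop}}\langle M,\nu[\tau\mapsto\nu(\tau)[x\mapsto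 t]]\rangle$. **Combined transition system.** States are pairs of program state and memory state. Steps: (1) joint program and memory steps with common $(\tau,\ell)$ for read/write/RMW labels; (2) program $\varepsilon$-steps leaving memory unchanged; (3) $\mathsf{prop}$ steps leaving the program state unchanged. States without successors get an idling self-loop. **Fairness and LTL.** A run is an infinite sequence of consecutive transitions from an initial state. Program transitions are identified by the position $l$ of the executed command, and internal transitions by their label $\mathsf{prop}$. The command of thread $\tau$ at position $l$ is enabled in a state if $pc(\tau)=l$ (for positions $l$ carrying a command); $\mathsf{prop}$ is enabled if some $\mathsf{prop}$-labelled transition leaves the state. A run is fair w.r.t. the just set if every member of the just set that is enabled at all positions $i\ge k$ of the run, for some $k$, is taken at some position $i\ge k$. $\mathsf{at}\_l$ holds in a state if $pc(\tau)=l$ for some thread $\tau$. A system fairly satisfies $\Box(\varphi\rightarrow\Diamond\psi)$ if in every fair run, for every position $i$ whose state satisfies $\varphi$, there is $j\ge i$ whose state satisfies $\psi$. -}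

module Defs where

open import Data.Fin using (Fin; zero; suc; combine)
open import Data.Fin.Patterns using (0F; 1F; 2F; 3F; 4F)
open import Data.List using (List; []; _∷_; _++_)
import Data.List as List
open import Data.List.Membership.Propositional using (_∈_; _∉_)
open import Data.Maybe using (Maybe; just; nothing)
open import Data.Nat using (ℕ; zero; suc; _+_; _*_; _≤_; _<_)
open import Data.Product using (∃; ∃-syntax; _×_; _,_; proj₁; proj₂)
open import Data.Vec using (Vec; lookup; _[_]≔_; replicate; tabulate)
import Data.Vec as Vec
open import Relation.Binary.PropositionalEquality using (_≡_; _≢_)
open import Relation.Nullary using (¬_)

record TransitionSystem : Set₁ where
  infix 4 _⟶[_]_
  field
    State   : Set
    Action  : Set
    initial : State
    _⟶[_]_  : State → Action → State → Set

module _ (S : TransitionSystem) where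
  open TransitionSystem S

  -- `nothing` labels the idling self-loop of a state without successors.
  data Transition : State → Maybe Action → State → Set where
    step : ∀ {s a s′} → s ⟶[ a ] s′ → Transition s (just a) s′
    idle : ∀ {s} → (∀ {a s′} → ¬ (s ⟶[ a ] s′)) → Transition s nothing s

  record Run : Set where
    field
      state : ℕ → State
      label : ℕ → Maybe Action
      start : state 0 ≡ initial
      next  : ∀ i → Transition (state i) (label i) (state (suc i))

  record JustSet : Set₁ where
    field
      Member  : Set
      Enabled : Member → State → Set
      Takes   : Member → Action → Set

  module _ (J : JustSet) where
    open JustSet J
    open Run

    Taken : Member → Maybe Action → Set
    Taken j α = ∃[ a ] α ≡ just a × Takes j a

    Fair : Run → Set
    Fair r = ∀ (j : Member) (k : ℕ) →
             (∀ i → k ≤ i → Enabled j (state r i)) →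
             ∃[ i ] k ≤ i × Taken j (label r i)

    FairlySatisfies□[_⇒◇_] : (φ ψ : State → Set) → Set
    FairlySatisfies□[ φ ⇒◇ ψ ] =
      ∀ (r : Run) → Fair r →
      ∀ i → φ (state r i) → ∃[ j ] i ≤ j × ψ (state r j)

-- n counts the threads other than the initializing thread T₀.  Views, stores
-- and the other maps with finite domain are vectors, so that propositional
-- equality of states is extensional.

module Semantics (n #loc #reg : ℕ) (Pos : Set) where

  Tid Loc Reg Val Time : Set
  Tid  = Fin (suc n)
  Loc  = Fin #loc
  Reg  = Fin #reg
  Val  = ℕ
  Time = ℕ

  T₀ : Tid
  T₀ = zero

  data Access : Set where
    R   : (x : Loc) (v : Val) → Access
    W   : (x : Loc) (v : Val) → Access
    RMW : (x : Loc) (vr vw : Val) → Access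

  data Label : Set where
    ε   : Label
    acc : Access → Label

  Store : Set
  Store = Vec Val #reg

  data Expr : Set where
    lit : Val → Expr
    reg : Reg → Expr

  ⟦_⟧ : Expr → Store → Val
  ⟦ lit v ⟧ γ = v
  ⟦ reg a ⟧ γ = lookup γ a

  data Test : Set where
    _≠_ : Expr → Expr → Test

  Holds : Test → Store → Set
  Holds (e ≠ e′) γ = ⟦ e ⟧ γ ≢ ⟦ e′ ⟧ γ

  infix 5 _:=LOAD_ _:=FADD⟨_,_⟩ while_loop_

  data Command : Set where
    _:=LOAD_     : Reg → Loc → Command
    _:=FADD⟨_,_⟩ : Reg → Loc → Expr → Command
    FADD⟨_,_⟩    : Loc → Expr → Command
    while_loop_  : Test → List (Pos × Command) → Command

  Block : Set
  Block = List (Pos × Command)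

  -- A thread's (remaining) code: commands with their positions, followed by
  -- the position of the end of the code, which carries no command.
  record Code : Set where
    constructor _end_
    field
      body : Block
      exit : Pos
  open Code public

  firstPos : Code → Pos
  firstPos ([]              end l) = l
  firstPos (((l , _) ∷ _) end _) = l

  commandPositions : Block → List Pos
  commandPositions []                           = []
  commandPositions ((l , (while _ loop b)) ∷ c) =
    l ∷ commandPositions b ++ commandPositions c
  commandPositions ((l , _) ∷ c)                = l ∷ commandPositions c

  Program : Set
  Program = Vec Code (suc n)

  data CodeStep : Block × Store → Label → Pos → Block × Store → Set where
    load : ∀ {l a x c γ} v →
      CodeStep ((l , (a :=LOAD x)) ∷ c , γ)
               (acc (R x v)) l
               (c , γ [ a ]≔ v)
    fadd : ∀ {l a x e c γ} v →
      CodeStep ((l , (a :=FADD⟨ x , e ⟩)) ∷ c , γ)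
               (acc (RMW x v (v + ⟦ e ⟧ γ))) l
               (c , γ [ a ]≔ v)
    fadd′ : ∀ {l x e c γ} v →
      CodeStep ((l , FADD⟨ x , e ⟩) ∷ c , γ)
               (acc (RMW x v (v + ⟦ e ⟧ γ))) l
               (c , γ)
    enter : ∀ {l t b c γ} → Holds t γ →
      CodeStep ((l , (while t loop b)) ∷ c , γ)
               ε l
               (b ++ (l , (while t loop b)) ∷ c , γ)
    leave : ∀ {l t b c γ} → ¬ Holds t γ →
      CodeStep ((l , (while t loop b)) ∷ c , γ)
               ε l
               (c , γ)

  record ProgState : Set where
    constructor mkProg
    field
      code  : Program
      store : Store
      pc    : Vec Pos (suc n)
  open ProgState public

  initProg : Program → ProgState
  initProg P = mkProg P (replicate #reg 0) (Vec.map firstPos P)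

  data ProgStep : ProgState → Tid → Label → Pos → ProgState → Set where
    step : ∀ {P γ p τ b e ℓ l b′ γ′} →
      lookup p τ ≡ l →
      lookup P τ ≡ (b end e) →
      CodeStep (b , γ) ℓ l (b′ , γ′) →
      ProgStep (mkProg P γ p) τ ℓ l
               (mkProg (P [ τ ]≔ (b′ end e)) γ′
                       (p [ τ ]≔ firstPos (b′ end e)))

  View : Set
  View = Vec Time #loc

  record Message : Set where
    constructor ⟨_∶_＠_,_,_⟩
    field
      loc  : Loc
      val  : Val
      time : Time
      tid  : Tid
      view : View

  -- M represents a finite set of messages; it is only ever inspected
  -- through membership.
  record Memory : Set where
    constructor ⟨_,_⟩
    field
      M : List Message
      ν : Vec View (suc n)
  open Memory public

  viewAt : Memory → Tid → Loc → Time
  viewAt q τ x = lookup (lookup (ν q) τ) x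

  V₀ : View
  V₀ = replicate #loc 0

  initMem : Memory
  initMem = ⟨ List.map (λ x → ⟨ x ∶ 0 ＠ 0 , T₀ , V₀ ⟩) (List.allFin #loc)
            , replicate (suc n) V₀ ⟩

  data MemStep : Memory → Tid → Access → Memory → Set where
    read : ∀ {q τ x v t τ′ V} →
      ⟨ x ∶ v ＠ t , τ′ , V ⟩ ∈ M q →
      viewAt q τ x ≡ t →
      MemStep q τ (R x v) q
    write : ∀ {q τ x v} t →
      (∀ {v′ τ′ V′} → ⟨ x ∶ v′ ＠ t , τ′ , V′ ⟩ ∉ M q) →
      viewAt q τ x < t →
      let V = lookup (ν q) τ [ x ]≔ t in
      MemStep q τ (W x v)
              ⟨ ⟨ x ∶ v ＠ t , τ , V ⟩ ∷ M q , ν q [ τ ]≔ V ⟩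
    rmw : ∀ {q q′ τ x vr vw} →
      MemStep q τ (R x vr) q →
      MemStep q τ (W x vw) q′ →
      viewAt q′ τ x ≡ viewAt q τ x + 1 →
      MemStep q τ (RMW x vr vw) q′

  data PropStep : Memory → Memory → Set where
    propagate : ∀ {q x v t τ′ V} τ →
      ⟨ x ∶ v ＠ t , τ′ , V ⟩ ∈ M q →
      viewAt q τ x < t →
      PropStep q ⟨ M q , ν q [ τ ]≔ (lookup (ν q) τ [ x ]≔ t) ⟩

  State : Set
  State = ProgState × Memory

  data Action : Set where
    cmd  : Tid → Label → Pos → Action
    prop : Action

  data CombinedStep : State → Action → State → Set where
    joint : ∀ {p q τ a l p′ q′} →
      ProgStep p τ (acc a) l p′ →
      MemStep q τ a q′ →
      CombinedStep (p , q) (cmd τ (acc a) l) (p′ , q′)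
    silent : ∀ {p q τ l p′} →
      ProgStep p τ ε l p′ →
      CombinedStep (p , q) (cmd τ ε l) (p′ , q)
    internal : ∀ {p q q′} →
      PropStep q q′ →
      CombinedStep (p , q) prop (p , q′)

  _∥StrCOH : Program → TransitionSystem
  P ∥StrCOH = record
    { State   = State
    ; Action  = Action
    ; initial = initProg P , initMem
    ; _⟶[_]_  = CombinedStep
    }

  at : Pos → State → Set
  at l (p , _) = ∃[ τ ] lookup (pc p) τ ≡ l

  data Fairness (P : Program) : Set where
    command : ∀ τ l → l ∈ commandPositions (body (lookup P τ)) → Fairness P
    prop    : Fairness P

  commands+prop : (P : Program) → JustSet (P ∥StrCOH)
  commands+prop P = record
    { Member  = Fairness P
    ; Enabled = λ where
        (command τ l _) (p , _) → lookup (pc p) τ ≡ l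
        prop            s       → ∃[ s′ ] CombinedStep s prop s′
    ; Takes   = λ where
        (command _ l _) a → ∃[ τ ] ∃[ ℓ ] a ≡ cmd τ ℓ l
        prop            a → a ≡ prop
    }

-- The thread T_k (1 ≤ k ≤ n) is `suc k` for k : Fin n.

module Ticket (n : ℕ) where

  -- (τ , j) stands for the position l_{τ j}; the initializing thread
  -- stays forever at the otherwise unused position (zero , 0F).
  Position : Set
  Position = Fin (suc n) × Fin 5

  open Semantics n 2 (2 * n) Position public

  next srv : Loc
  next = 0F
  srv  = 1F

  nxt s : Fin n → Reg
  nxt k = combine {2} 0F k
  s   k = combine {2} 1F k

  l : Fin n → Fin 5 → Position
  l k j = suc k , j

  thread : Fin n → Code
  thread k =
    ( (l k 0F , (nxt k :=FADD⟨ next , lit 1 ⟩))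
    ∷ (l k 1F , (while reg (s k) ≠ reg (nxt k) loop
          ((l k 2F , (s k :=LOAD srv)) ∷ [])))
    ∷ (l k 3F , FADD⟨ srv , lit 1 ⟩)
    ∷ []
    ) end l k 4F

  ticket : Program
  ticket = ([] end (zero , 0F)) Vec.∷ tabulate thread

{-# OPTIONS --safe #-}
module Submission where

open import Defs
open import Axiom.ExcludedMiddle using (ExcludedMiddle)
open import Data.Fin using (Fin; zero; suc)
open import Data.Fin.Patterns using (0F; 1F; 2F; 3F; 4F)
open import Data.Fin.Properties
  using (combine-injectiveˡ; combine-injectiveʳ; suc-injective; injective⇒≤; toℕ<n; toℕ-injective)
import Data.Fin.Properties as Fin
open import Data.List using (List; []; _∷_)
open import Data.List.Membership.Propositional using (_∈_)
open import Data.List.Membership.Propositional.Properties using (∈-allFin; ∈-map⁺; ∈-map⁻)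
open import Data.List.Relation.Unary.Any using (here; there)
open import Data.Nat using (ℕ; zero; suc; _+_; _*_; _≤_; _<_; z≤n; s≤s; _≤?_)
open import Data.Nat.Properties hiding (suc-injective)
open import Data.Product using (∃-syntax; _×_; _,_; proj₁; proj₂; uncurry)
open import Data.Sum using (_⊎_; inj₁; inj₂)
open import Data.Vec using (Vec; []; _∷_; lookup; _[_]≔_; sum; tabulate)
import Data.Vec as Vec
open import Data.Vec.Properties
  using (lookup∘update; lookup∘update′; map-[]≔; lookup-map; lookup-replicate; lookup∘tabulate)
open import Function using (_∘_; id)
open import Level using (0ℓ)
open import Relation.Binary.PropositionalEquality
open import Relation.Nullary using (yes; no; contradiction)

-- Since an RMW must take the timestamp right after the thread's view and that
-- timestamp must be free, every FADD reads the newest message; as all writes are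
-- increments, values coincide with timestamps.  Let N and S be the largest timestamps
-- of next and srv.  The tickets of the threads past l₀ are exactly 0, …, N − 1, each
-- held once, and those below S belong to the threads that have finished.
-- Hence the holder of ticket S is still active and S does not change until it finishes.
-- Timestamps never exceed n, so only boundedly many propagations can occur; fairness
-- of prop therefore brings the view of that holder up to S, after which fairness
-- of its commands drives it through the loop and the release.  Induction on the
-- distance between a ticket and S then serves every thread.

-- Leads-to properties along a fair run.

module LeadsTo
  (em : ExcludedMiddle 0ℓ) {S : TransitionSystem} {J : JustSet S}
  (r : Run S) (fair : Fair S J r)
  (Inv : TransitionSystem.State S → Set)
  (inv : ∀ i → Inv (Run.state r i))
  where
  open TransitionSystem S
  open JustSet J
  open Run r

  infix 4 _↝_
  -- A record rather than a plain function type, so that unification can recover `P` and `Q`. The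
  -- run is the fixed `r`.
  record _↝_ (P Q : State → Set) : Set where
    constructor leadsTo
    field eventually : ∀ i → P (state i) → ∃[ j ] i ≤ j × Q (state j)
  open _↝_ public

  ↝-refl : ∀ {P Q} → (∀ {σ} → P σ → Q σ) → P ↝ Q
  ↝-refl P⇒Q .eventually i p = i , ≤-refl , P⇒Q p

  ↝-trans : ∀ {P Q R} → P ↝ Q → Q ↝ R → P ↝ R
  ↝-trans P↝Q Q↝R .eventually i p =
    let j , i≤j , q = eventually P↝Q i p
        k , j≤k , r = eventually Q↝R j q
    in  k , ≤-trans i≤j j≤k , r

  ↝-case : ∀ {P Q R} → P ↝ R → Q ↝ R → (λ σ → P σ ⊎ Q σ) ↝ R
  ↝-case P↝R Q↝R .eventually i (inj₁ p) = eventually P↝R i p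
  ↝-case P↝R Q↝R .eventually i (inj₂ q) = eventually Q↝R i q

  stable : ∀ {P : State → Set} →
    (∀ {σ a σ′} → Inv σ → P σ → σ ⟶[ a ] σ′ → P σ′) →
    ∀ {i j} → i ≤ j → P (state i) → P (state j)
  stable {P} keep {i} i≤j p = subst (P ∘ state) (m∸n+n≡m i≤j) (later _)
    where
    kept : ∀ {σ α σ′} → Inv σ → P σ → Transition S σ α σ′ → P σ′
    kept I p (step a) = keep I p a
    kept I p (idle _) = p

    later : ∀ d → P (state (d + i))
    later zero    = p
    later (suc d) = kept (inv (d + i)) (later d) (next (d + i))

  -- If `Q` never held from `i₀` on, `P` would persist, `m` would stay enabled, and fairness would
  -- force it to be taken, which establishes `Q`. Excluded middle decides whether `Q` is ever
  -- reached.
  ensures : ∀ {P Q : State → Set} (m : Member) →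
    (∀ {σ} → Inv σ → P σ → Enabled m σ) →
    (∀ {σ a σ′} → Inv σ → P σ → σ ⟶[ a ] σ′ → P σ′ ⊎ Q σ′) →
    (∀ {σ a σ′} → Inv σ → P σ → σ ⟶[ a ] σ′ → Takes m a → Q σ′) →
    P ↝ Q
  ensures {P} {Q} m enabled unless takes .eventually i₀ p₀ with em {∃[ j ] i₀ ≤ j × Q (state j)}
  ... | yes found = found
  ... | no never = contradiction taken never
    where
    successor : ∀ {σ α σ′} → Inv σ → P σ → Transition S σ α σ′ → P σ′ ⊎ Q σ′
    successor I p (step a) = unless I p a
    successor I p (idle _) = inj₁ p

    forever : ∀ d → P (state (d + i₀))
    forever zero    = p₀
    forever (suc d) with successor (inv (d + i₀)) (forever d) (next (d + i₀))
    ... | inj₁ p = p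
    ... | inj₂ q = contradiction (suc d + i₀ , m≤n+m i₀ (suc d) , q) never

    always : ∀ i → i₀ ≤ i → P (state i)
    always i i₀≤i = subst (P ∘ state) (m∸n+n≡m i₀≤i) (forever _)

    fires : ∀ {σ α σ′} → Inv σ → P σ → Transition S σ α σ′ → Taken S J m α → Q σ′
    fires I p (step a) (_ , refl , t) = takes I p a t

    taken : ∃[ j ] i₀ ≤ j × Q (state j)
    taken with fair m i₀ (λ i i₀≤i → enabled (inv i) (always i i₀≤i))
    ... | i , i₀≤i , t = suc i , m≤n⇒m≤1+n i₀≤i , fires (inv i) (always i i₀≤i) (next i) t

  -- Each use of `raise` that misses `Q` lifts the known lower bound `m` on `f` by one, which the
  -- upper bound `b` permits only finitely often.
  climb : ∀ {P Q : State → Set} (f : State → ℕ) b →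
    (∀ {σ} → Inv σ → f σ ≤ b) →
    (∀ m → (λ σ → P σ × m ≤ f σ) ↝ (λ σ → Q σ ⊎ (P σ × m < f σ))) →
    P ↝ Q
  climb {P} {Q} f b f≤b raise = ↝-trans (↝-refl (_, z≤n)) (go (suc b) 0 (+-identityʳ (suc b)))
    where
    -- The sum `fuel + m` stays `suc b`, so once the fuel is spent `m ≤ f` reads `suc b ≤ f`,
    -- against `f≤b`.
    go : ∀ fuel m → fuel + m ≡ suc b → (λ σ → P σ × m ≤ f σ) ↝ Q
    go zero       m refl .eventually i (_ , m≤f) = contradiction (f≤b (inv i)) (<⇒≱ m≤f)
    go (suc fuel) m eq =
      ↝-trans (raise m) (↝-case (↝-refl id) (go fuel (suc m) (trans (+-suc fuel m) eq)))

-- Sums of vectors.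

lookup≤⇒sum≤ : ∀ {m} (xs : Vec ℕ m) {b} → (∀ i → lookup xs i ≤ b) → sum xs ≤ m * b
lookup≤⇒sum≤ []       h = z≤n
lookup≤⇒sum≤ (x ∷ xs) h = +-mono-≤ (h zero) (lookup≤⇒sum≤ xs (h ∘ suc))

sum-[]≔-< : ∀ {m} (xs : Vec ℕ m) i {y} → lookup xs i < y → sum xs < sum (xs [ i ]≔ y)
sum-[]≔-< (x ∷ xs) zero    x<y = +-monoˡ-< (sum xs) x<y
sum-[]≔-< (x ∷ xs) (suc i) x<y = +-monoʳ-< x (sum-[]≔-< xs i x<y)

-- StrCOH memories under increments by one.

module Coherence (n #loc #reg : ℕ) (Pos : Set) where
  open Semantics n #loc #reg Pos

  Views : Set
  Views = Vec View (suc n)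

  advance : Views → Tid → Loc → Time → Views
  advance ν τ x t = ν [ τ ]≔ (lookup ν τ [ x ]≔ t)

  module _ (ν : Views) (τ : Tid) (x : Loc) (t : Time) where

    lookup-advance : lookup (lookup (advance ν τ x t) τ) x ≡ t
    lookup-advance =
      trans (cong (λ V → lookup V x) (lookup∘update τ ν _)) (lookup∘update x (lookup ν τ) t)

    lookup-advance-loc : ∀ {y} → y ≢ x →
      lookup (lookup (advance ν τ x t) τ) y ≡ lookup (lookup ν τ) y
    lookup-advance-loc {y} y≢x =
      trans (cong (λ V → lookup V y) (lookup∘update τ ν _)) (lookup∘update′ y≢x (lookup ν τ) t)

    lookup-advance-tid : ∀ {τ′} → τ′ ≢ τ → ∀ y →
      lookup (lookup (advance ν τ x t) τ′) y ≡ lookup (lookup ν τ′) y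
    lookup-advance-tid τ′≢τ y = cong (λ V → lookup V y) (lookup∘update′ τ′≢τ ν _)

    data Advanced (τ′ : Tid) (y : Loc) : Set where
      here  : τ′ ≡ τ → y ≡ x → Advanced τ′ y
      other : lookup (lookup (advance ν τ x t) τ′) y ≡ lookup (lookup ν τ′) y → Advanced τ′ y

    advanced : ∀ τ′ y → Advanced τ′ y
    advanced τ′ y with τ′ Fin.≟ τ | y Fin.≟ x
    ... | yes refl | yes refl = here refl refl
    ... | yes refl | no y≢x   = other (lookup-advance-loc y≢x)
    ... | no τ′≢τ  | _        = other (lookup-advance-tid τ′≢τ y)

    advance-increasing : lookup (lookup ν τ) x ≤ t →
      ∀ τ′ y → lookup (lookup ν τ′) y ≤ lookup (lookup (advance ν τ x t) τ′) y
    advance-increasing ≤t τ′ y with advanced τ′ y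
    ... | here refl refl = ≤-trans ≤t (≤-reflexive (sym lookup-advance))
    ... | other eq       = ≤-reflexive (sym eq)

    advance-bounded : (B : View) → t ≤ lookup B x →
      (∀ τ′ y → lookup (lookup ν τ′) y ≤ lookup B y) →
      ∀ τ′ y → lookup (lookup (advance ν τ x t) τ′) y ≤ lookup B y
    advance-bounded B t≤B ν≤B τ′ y with advanced τ′ y
    ... | here refl refl = ≤-trans (≤-reflexive lookup-advance) t≤B
    ... | other eq       = ≤-trans (≤-reflexive eq) (ν≤B τ′ y)

  -- The rank that limits propagation: no memory step lowers it, and every propagation raises it
  -- strictly.
  total : Memory → ℕ
  total q = sum (Vec.map sum (ν q))

  advance-total : ∀ {ms ms′} ν τ x {t} → lookup (lookup ν τ) x < t →
    total ⟨ ms , ν ⟩ < total ⟨ ms′ , advance ν τ x t ⟩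
  advance-total ν τ x <t =
    subst (λ sums → sum (Vec.map sum ν) < sum sums) (sym (map-[]≔ sum ν τ))
      (sum-[]≔-< (Vec.map sum ν) τ
        (subst (_< sum (lookup ν τ [ x ]≔ _)) (sym (lookup-map τ sum ν)) (sum-[]≔-< (lookup ν τ) x <t)))

  mem-total : ∀ {q τ a q′} → MemStep q τ a q′ → total q ≤ total q′
  mem-total (read _ _)             = ≤-refl
  mem-total {q} {τ} (write {x = x} t _ <t) = <⇒≤ (advance-total {M q} {M q} (ν q) τ x <t)
  mem-total (rmw _ w _)            = mem-total w

  prop-total : ∀ {q q′} → PropStep q q′ → total q < total q′
  prop-total {q} (propagate {x = x} τ _ <t) = advance-total {M q} {M q} (ν q) τ x <t

  mem-keeps : ∀ {q τ a q′ m} → MemStep q τ a q′ → m ∈ M q → m ∈ M q′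
  mem-keeps (read _ _)    m∈ = m∈
  mem-keeps (write _ _ _) m∈ = there m∈
  mem-keeps (rmw _ w _)   m∈ = mem-keeps w m∈

  HasMessage : Loc → Time → Memory → Set
  HasMessage x t q = ∃[ v ] ∃[ τ ] ∃[ V ] ⟨ x ∶ v ＠ t , τ , V ⟩ ∈ M q

  -- The shape of the memory of a program whose only writes are FADD(x, 1):
  -- each location x carries exactly the timestamps 0, …, T x, and every
  -- message stores its own timestamp.
  record Coherent (q : Memory) (T : View) : Set where
    field
      value   : ∀ {x v t τ V} → ⟨ x ∶ v ＠ t , τ , V ⟩ ∈ M q → v ≡ t
      bounded : ∀ {x v t τ V} → ⟨ x ∶ v ＠ t , τ , V ⟩ ∈ M q → t ≤ lookup T x
      full    : ∀ x {t} → t ≤ lookup T x → HasMessage x t q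
      view≤   : ∀ τ x → viewAt q τ x ≤ lookup T x
  open Coherent

  initMem-coherent : Coherent initMem V₀
  initMem-coherent = record
    { value   = λ m∈ → proj₁ (initial m∈)
    ; bounded = λ m∈ → ≤-trans (≤-reflexive (proj₂ (initial m∈))) z≤n
    ; full    = λ x {t} t≤ →
        0 , T₀ , V₀ ,
        subst (λ t → ⟨ x ∶ 0 ＠ t , T₀ , V₀ ⟩ ∈ M initMem)
              (sym (n≤0⇒n≡0 (≤-trans t≤ (≤-reflexive (lookup-replicate x 0)))))
              (∈-map⁺ _ (∈-allFin x))
    ; view≤   = λ τ x → ≤-reflexive (cong (λ V → lookup V x) (lookup-replicate τ V₀))
    }
    where
    initial : ∀ {x v t τ V} → ⟨ x ∶ v ＠ t , τ , V ⟩ ∈ M initMem → v ≡ t × t ≡ 0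
    initial m∈ with ∈-map⁻ _ m∈
    ... | _ , _ , refl = refl , refl

  read-coherent : ∀ {q T τ x v q′} → Coherent q T → MemStep q τ (R x v) q′ →
    q′ ≡ q × v ≡ viewAt q τ x
  read-coherent C (read m∈ eq) = refl , trans (value C m∈) (sym eq)

  prop-coherent : ∀ {q T q′} → Coherent q T → PropStep q q′ →
    Coherent q′ T × (∀ τ x → viewAt q τ x ≤ viewAt q′ τ x)
  prop-coherent {q} {T} C (propagate {x = x} {t = t} τ m∈ <t) =
    record { value = value C ; bounded = bounded C ; full = full C
           ; view≤ = advance-bounded (ν q) τ x t T (bounded C m∈) (view≤ C) } ,
    advance-increasing (ν q) τ x t (<⇒≤ <t)

  record Incremented (q : Memory) (T : View) (τ : Tid) (x : Loc) (v : Val) (q′ : Memory) : Set where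
    field
      latest   : v ≡ lookup T x
      coherent : Coherent q′ (T [ x ]≔ suc (lookup T x))
      latest-view : viewAt q τ x ≡ lookup T x
      views    : ν q′ ≡ advance (ν q) τ x (suc (lookup T x))

  -- The written timestamp is the successor of the view and must be free. Were the view below
  -- `lookup T x`, `full` would supply a message with exactly that timestamp; so the view is already
  -- maximal and the newest message is read.
  rmw-coherent : ∀ {q T τ x v q′} → Coherent q T → MemStep q τ (RMW x v (v + 1)) q′ →
    Incremented q T τ x v q′
  rmw-coherent {q} {T} {τ} {x} {v} C (rmw (read m∈ refl) (write t fresh <t) eq) = record
    { latest      = trans (value C m∈) view≡T
    ; coherent    = record { value = value′ ; bounded = bounded′ ; full = full′ ; view≤ = view≤′ }
    ; latest-view = view≡T
    ; views       = cong (advance (ν q) τ x) t≡1+T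
    }
    where
    t≡1+view : t ≡ suc (viewAt q τ x)
    t≡1+view = trans (trans (sym (lookup-advance (ν q) τ x t)) eq) (+-comm _ 1)

    view≡T : viewAt q τ x ≡ lookup T x
    view≡T with viewAt q τ x <? lookup T x
    ... | no ≮T = ≤-antisym (view≤ C τ x) (≮⇒≥ ≮T)
    ... | yes <T with full C x (subst (_≤ lookup T x) (sym t≡1+view) <T)
    ... | _ , _ , _ , m∈′ = contradiction m∈′ fresh

    t≡1+T : t ≡ suc (lookup T x)
    t≡1+T = trans t≡1+view (cong suc view≡T)

    T′ : View
    T′ = T [ x ]≔ suc (lookup T x)

    T′-x : lookup T′ x ≡ suc (lookup T x)
    T′-x = lookup∘update x T _

    T≤T′ : ∀ y → lookup T y ≤ lookup T′ y
    T≤T′ y with y Fin.≟ x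
    ... | yes refl = ≤-trans (n≤1+n _) (≤-reflexive (sym T′-x))
    ... | no y≢x   = ≤-reflexive (sym (lookup∘update′ y≢x T _))

    t≤T′ : t ≤ lookup T′ x
    t≤T′ = ≤-reflexive (trans t≡1+T (sym T′-x))

    ms′ : List Message
    ms′ = ⟨ x ∶ v + 1 ＠ t , τ , lookup (ν q) τ [ x ]≔ t ⟩ ∷ M q

    value′ : ∀ {y w u τ′ V} → ⟨ y ∶ w ＠ u , τ′ , V ⟩ ∈ ms′ → w ≡ u
    -- The message read stores its own timestamp, which is the view, so `v + 1` is the new
    -- timestamp.
    value′ (here refl) = trans (+-comm v 1) (trans (cong suc (value C m∈)) (sym t≡1+view))
    value′ (there m)   = value C m

    bounded′ : ∀ {y w u τ′ V} → ⟨ y ∶ w ＠ u , τ′ , V ⟩ ∈ ms′ → u ≤ lookup T′ y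
    bounded′ (here refl) = t≤T′
    bounded′ (there m)   = ≤-trans (bounded C m) (T≤T′ _)

    old : ∀ {y u} → u ≤ lookup T y → HasMessage y u ⟨ ms′ , advance (ν q) τ x t ⟩
    old {y} u≤ with full C y u≤
    ... | w , τ′ , V , m = w , τ′ , V , there m

    full′ : ∀ y {u} → u ≤ lookup T′ y → HasMessage y u ⟨ ms′ , advance (ν q) τ x t ⟩
    full′ y {u} u≤ with y Fin.≟ x
    ... | no y≢x = old (≤-trans u≤ (≤-reflexive (lookup∘update′ y≢x T _)))
    ... | yes refl with m≤n⇒m<n∨m≡n (≤-trans u≤ (≤-reflexive T′-x))
    ... | inj₁ (s≤s u≤T) = old u≤T
    ... | inj₂ u≡ = _ , _ , _ ,
      here (cong (λ u → ⟨ x ∶ v + 1 ＠ u , τ , lookup (ν q) τ [ x ]≔ t ⟩) (trans u≡ (sym t≡1+T)))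

    view≤′ : ∀ τ′ y → viewAt ⟨ ms′ , advance (ν q) τ x t ⟩ τ′ y ≤ lookup T′ y
    view≤′ = advance-bounded (ν q) τ x t T′ t≤T′ (λ τ′ y → ≤-trans (view≤ C τ′ y) (T≤T′ y))

-- Control flow of the ticket threads.

module TicketLock (n : ℕ) where
  open Ticket n
  open Coherence n 2 (2 * n) Position
  open Coherent

  nxt-injective : ∀ {k k′} → nxt k ≡ nxt k′ → k ≡ k′
  nxt-injective {k} {k′} = combine-injectiveʳ {2} 0F k 0F k′

  s-injective : ∀ {k k′} → s k ≡ s k′ → k ≡ k′
  s-injective {k} {k′} = combine-injectiveʳ {2} 1F k 1F k′

  nxt≢s : ∀ {k k′} → nxt k ≢ s k′
  nxt≢s {k} {k′} eq with combine-injectiveˡ {2} 0F k 1F k′ eq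
  ... | ()

  exiting spinning : Fin n → Block
  exiting k = (l k 3F , FADD⟨ srv , lit 1 ⟩) ∷ []
  spinning k =
    (l k 1F , (while reg (s k) ≠ reg (nxt k) loop ((l k 2F , (s k :=LOAD srv)) ∷ []))) ∷ exiting k

  -- The position alone determines the remaining code: after the body at `2F` the same loop follows,
  -- so unrolling never creates further blocks.
  remaining : Fin n → Fin 5 → Block
  remaining k 0F = body (thread k)
  remaining k 1F = spinning k
  remaining k 2F = (l k 2F , (s k :=LOAD srv)) ∷ spinning k
  remaining k 3F = exiting k
  remaining k 4F = []

  firstPos-remaining : ∀ k j → firstPos (remaining k j end l k 4F) ≡ l k j
  firstPos-remaining k 0F = refl
  firstPos-remaining k 1F = refl
  firstPos-remaining k 2F = refl
  firstPos-remaining k 3F = refl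
  firstPos-remaining k 4F = refl

  data ThreadStep (k : Fin n) (γ : Store) : Fin 5 → Label → Fin 5 → Store → Set where
    take    : ∀ v → ThreadStep k γ 0F (acc (RMW next v (v + 1))) 1F (γ [ nxt k ]≔ v)
    enter   : lookup γ (s k) ≢ lookup γ (nxt k) → ThreadStep k γ 1F ε 2F γ
    leave   : lookup γ (s k) ≡ lookup γ (nxt k) → ThreadStep k γ 1F ε 3F γ
    load    : ∀ v → ThreadStep k γ 2F (acc (R srv v)) 1F (γ [ s k ]≔ v)
    release : ∀ v → ThreadStep k γ 3F (acc (RMW srv v (v + 1))) 4F γ

  code-step : ∀ {k γ ℓ p b γ′} j → CodeStep (remaining k j , γ) ℓ p (b , γ′) →
    p ≡ l k j × ∃[ j′ ] b ≡ remaining k j′ × ThreadStep k γ j ℓ j′ γ′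
  code-step 0F (fadd v)  = refl , 1F , refl , take v
  code-step 1F (enter h) = refl , 2F , refl , enter h
  -- Leaving the loop yields only the double negation of the equality; decidability on ℕ removes it.
  code-step {k} {γ} 1F (leave ¬h) with lookup γ (s k) ≟ lookup γ (nxt k)
  ... | yes eq = refl , 3F , refl , leave eq
  ... | no neq = contradiction neq ¬h
  code-step 2F (load v)  = refl , 1F , refl , load v
  code-step 3F (fadd′ v) = refl , 4F , refl , release v
  code-step 4F ()

  At : ProgState → Fin n → Fin 5 → Set
  At p k j = lookup (code p) (suc k) ≡ (remaining k j end l k 4F) × lookup (pc p) (suc k) ≡ l k j

  -- `pc₀` keeps `T₀` off every position `l k j`, so that `at (l k j)` can only be due to thread
  -- `suc k`.
  record WellFormed (p : ProgState) : Set where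
    field
      code₀  : body (lookup (code p) zero) ≡ []
      pc₀    : proj₁ (lookup (pc p) zero) ≡ zero
      thread-at : ∀ k → ∃[ j ] At p k j
  open WellFormed

  data Progress (p : ProgState) : Tid → Label → Position → ProgState → Set where
    progress : ∀ {k j ℓ j′ p′} →
      At p k j → At p′ k j′ →
      ThreadStep k (store p) j ℓ j′ (store p′) →
      (∀ k′ → k′ ≢ k → lookup (pc p′) (suc k′) ≡ lookup (pc p) (suc k′)) →
      WellFormed p′ →
      Progress p (suc k) ℓ (l k j) p′

  prog-step : ∀ {p τ ℓ o p′} → WellFormed p → ProgStep p τ ℓ o p′ → Progress p τ ℓ o p′
  prog-step {τ = zero} wf (step _ code≡ cs)
    with refl ← trans (sym (cong body code≡)) (code₀ wf) | () ← cs
  prog-step {p} {suc k} wf (step {e = e} {b′ = b′} pc≡ code≡ cs)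
    with j , at-code , at-pc ← thread-at wf k
    with refl ← trans (sym code≡) at-code
    with refl , j′ , refl , ts ← code-step j cs =
    progress (at-code , at-pc) moved ts others record
      { code₀ = trans (cong body (lookup∘update′ (λ ()) (code p) _)) (code₀ wf)
      ; pc₀ = trans (cong proj₁ (lookup∘update′ (λ ()) (pc p) _)) (pc₀ wf)
      ; thread-at = threads }
    where
    code′ = code p [ suc k ]≔ (b′ end e)
    pc′   = pc p [ suc k ]≔ firstPos (b′ end e)

    moved : At (mkProg code′ (store p) pc′) k j′
    moved = lookup∘update (suc k) (code p) _ ,
            trans (lookup∘update (suc k) (pc p) _) (firstPos-remaining k j′)

    others : ∀ k′ → k′ ≢ k → lookup pc′ (suc k′) ≡ lookup (pc p) (suc k′)
    others k′ k′≢k = lookup∘update′ (k′≢k ∘ suc-injective) (pc p) _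

    threads : ∀ k′ → ∃[ j ] At (mkProg code′ (store p) pc′) k′ j
    threads k′ with k′ Fin.≟ k
    ... | yes refl = j′ , moved
    ... | no k′≢k with thread-at wf k′
    ... | i , i-code , i-pc =
      i , trans (lookup∘update′ (k′≢k ∘ suc-injective) (code p) _) i-code
        , trans (others k′ k′≢k) i-pc

  -- Steps seen through the local data of threads.

  record Local : Set where
    constructor local
    field
      pos              : Fin 5
      ticket# seen time : ℕ
  open Local

  localOf : State → Fin n → Local
  localOf (p , q) k =
    local (proj₂ (lookup (pc p) (suc k))) (lookup (store p) (nxt k)) (lookup (store p) (s k))
          (viewAt q (suc k) srv)

  local-cong : ∀ {j j′ t t′ u u′ w w′} → j ≡ j′ → t ≡ t′ → u ≡ u′ → w ≡ w′ →
    local j t u w ≡ local j′ t′ u′ w′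
  local-cong refl refl refl refl = refl

  -- `N` and `S` are the largest timestamps of `next` and `srv`, and `time` is the view of `srv`.
  -- Since values equal timestamps, `take` obtains the ticket `N` and `load` copies `time`;
  -- `release` starts from the maximal view `S`.
  data Move (N S : ℕ) : Local → Local → ℕ → ℕ → Set where
    take    : ∀ {t u w} → Move N S (local 0F t u w) (local 1F N u w) (suc N) S
    enter   : ∀ {t u w} → u ≢ t → Move N S (local 1F t u w) (local 2F t u w) N S
    leave   : ∀ {t u w} → u ≡ t → Move N S (local 1F t u w) (local 3F t u w) N S
    load    : ∀ {t u w} → Move N S (local 2F t u w) (local 1F t w w) N S
    release : ∀ {t u} → Move N S (local 3F t u S) (local 4F t u (suc S)) N (suc S)

  data Refreshed : Local → Local → Set where
    refreshed : ∀ {j t u w w′} → w ≤ w′ → Refreshed (local j t u w) (local j t u w′)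

  refreshed-refl : ∀ {a} → Refreshed a a
  refreshed-refl = refreshed ≤-refl

  data Change (N S : ℕ) (σ : State) : Action → State → ℕ → ℕ → Set where
    moved : ∀ {k ℓ σ′ N′ S′} →
      Move N S (localOf σ k) (localOf σ′ k) N′ S′ →
      (∀ k′ → k′ ≢ k → localOf σ′ k′ ≡ localOf σ k′) →
      Change N S σ (cmd (suc k) ℓ (l k (pos (localOf σ k)))) σ′ N′ S′
    propagated : ∀ {σ′} →
      (∀ k → Refreshed (localOf σ k) (localOf σ′ k)) →
      Change N S σ prop σ′ N S

  -- An explicit vector, so that incrementing it at `next` or `srv` computes to `Bounds (suc N) S`
  -- or `Bounds N (suc S)`.
  Bounds : ℕ → ℕ → View
  Bounds N S = N ∷ S ∷ []

  record Step (N S : ℕ) (σ : State) (a : Action) (σ′ : State) : Set where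
    constructor mkStep
    field
      {N′ S′}     : ℕ
      wellFormed′ : WellFormed (proj₁ σ′)
      coherent′   : Coherent (proj₂ σ′) (Bounds N′ S′)
      change      : Change N S σ a σ′ N′ S′

  step-moved : ∀ {N S N′ S′ σ σ′ k j ℓ a b} →
    At (proj₁ σ) k j →
    localOf σ k ≡ a → localOf σ′ k ≡ b →
    Move N S a b N′ S′ →
    (∀ k′ → k′ ≢ k → localOf σ′ k′ ≡ localOf σ k′) →
    Change N S σ (cmd (suc k) ℓ (l k j)) σ′ N′ S′
  step-moved {N} {S} {N′} {S′} {σ} {σ′} {k} {j} {ℓ} at-j refl refl m others =
    subst (λ i → Change N S σ (cmd (suc k) ℓ (l k i)) σ′ N′ S′)
          (cong proj₂ (proj₂ at-j)) (moved m others)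

  -- The program step leaves the value read arbitrary; coherence of the memory determines it. A take
  -- receives `N`, a load receives the thread's view of `srv`, and a release finds that view at `S`.
  combined-step : ∀ {N S σ a σ′} →
    WellFormed (proj₁ σ) → Coherent (proj₂ σ) (Bounds N S) →
    CombinedStep σ a σ′ → Step N S σ a σ′
  combined-step {σ = p@(mkProg _ γ _) , q} {σ′ = p′@(mkProg _ _ _) , _} wf C (joint ps ms)
    with prog-step wf ps
  ... | progress {k} at-j at-j′ (take v) pc-others wf′ =
    mkStep wf′ coherent
      (step-moved at-j
        (local-cong (cong proj₂ (proj₂ at-j)) refl refl refl)
        (local-cong (cong proj₂ (proj₂ at-j′))
          (trans (lookup∘update (nxt k) γ v) latest)
          (lookup∘update′ (nxt≢s ∘ sym) γ v)
          (trans (cong (λ ν → lookup (lookup ν (suc k)) srv) views)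
                 (lookup-advance-loc (ν q) (suc k) next _ (λ ()))))
        take
        (λ k′ k′≢k → local-cong (cong proj₂ (pc-others k′ k′≢k))
          (lookup∘update′ (k′≢k ∘ nxt-injective) γ v)
          (lookup∘update′ (nxt≢s ∘ sym) γ v)
          (trans (cong (λ ν → lookup (lookup ν (suc k′)) srv) views)
                 (lookup-advance-tid (ν q) (suc k) next _ (k′≢k ∘ suc-injective) srv))))
    where open Incremented (rmw-coherent C ms)
  ... | progress {k} at-j at-j′ (load v) pc-others wf′
    with refl , v≡ ← read-coherent C ms =
    mkStep wf′ C
      (step-moved at-j
        (local-cong (cong proj₂ (proj₂ at-j)) refl refl refl)
        (local-cong (cong proj₂ (proj₂ at-j′))
          (lookup∘update′ nxt≢s γ v)
          (trans (lookup∘update (s k) γ v) v≡)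
          refl)
        load
        (λ k′ k′≢k → local-cong (cong proj₂ (pc-others k′ k′≢k))
          (lookup∘update′ nxt≢s γ v)
          (lookup∘update′ (k′≢k ∘ s-injective) γ v)
          refl))
  ... | progress {k} at-j at-j′ (release v) pc-others wf′ =
    mkStep wf′ coherent
      (step-moved at-j
        (local-cong (cong proj₂ (proj₂ at-j)) refl refl latest-view)
        (local-cong (cong proj₂ (proj₂ at-j′)) refl refl
          (trans (cong (λ ν → lookup (lookup ν (suc k)) srv) views)
                 (lookup-advance (ν q) (suc k) srv _)))
        release
        (λ k′ k′≢k → local-cong (cong proj₂ (pc-others k′ k′≢k)) refl refl
          (trans (cong (λ ν → lookup (lookup ν (suc k′)) srv) views)
                 (lookup-advance-tid (ν q) (suc k) srv _ (k′≢k ∘ suc-injective) srv))))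
    where open Incremented (rmw-coherent C ms)
  combined-step {σ = mkProg _ _ _ , _} {σ′ = mkProg _ _ _ , _} wf C (silent ps)
    with prog-step wf ps
  ... | progress at-j at-j′ (enter u≢t) pc-others wf′ =
    mkStep wf′ C
      (step-moved at-j
        (local-cong (cong proj₂ (proj₂ at-j)) refl refl refl)
        (local-cong (cong proj₂ (proj₂ at-j′)) refl refl refl)
        (enter u≢t)
        (λ k′ k′≢k → local-cong (cong proj₂ (pc-others k′ k′≢k)) refl refl refl))
  ... | progress at-j at-j′ (leave u≡t) pc-others wf′ =
    mkStep wf′ C
      (step-moved at-j
        (local-cong (cong proj₂ (proj₂ at-j)) refl refl refl)
        (local-cong (cong proj₂ (proj₂ at-j′)) refl refl refl)
        (leave u≡t)
        (λ k′ k′≢k → local-cong (cong proj₂ (pc-others k′ k′≢k)) refl refl refl))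
  combined-step wf C (internal ps) with prop-coherent C ps
  ... | C′ , grows = mkStep wf C′ (propagated λ k → refreshed (grows (suc k) srv))

  -- seen ≤ time ≤ S ≤ ticket# holds in the loop, so a thread in its critical section,
  -- where seen = ticket#, holds ticket S.
  data Phase (N S : ℕ) : Local → Set where
    idle     : ∀ {t u w} → Phase N S (local 0F t u w)
    testing  : ∀ {t u w} → S ≤ t → t < N → Phase N S (local 1F t u w)
    loading  : ∀ {t u w} → S ≤ t → t < N → Phase N S (local 2F t u w)
    critical : ∀ {t u w} → S ≤ t → t < N → u ≡ t → Phase N S (local 3F t u w)
    finished : ∀ {t u w} → t < S → Phase N S (local 4F t u w)

  record Consistent (N S : ℕ) (a : Local) : Set where
    constructor consistent
    field
      phase     : Phase N S a
      seen≤time : seen a ≤ time a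
      time≤S    : time a ≤ S
  open Consistent

  data Active : Fin 5 → Set where
    testing  : Active 1F
    loading  : Active 2F
    critical : Active 3F

  Started : Local → Set
  Started a = pos a ≢ 0F

  started-phase : ∀ {N S a} → Phase N S a → Started a →
    (Active (pos a) × S ≤ ticket# a × ticket# a < N) ⊎ (pos a ≡ 4F × ticket# a < S)
  started-phase idle                 st = contradiction refl st
  started-phase (testing S≤t t<N)    st = inj₁ (testing , S≤t , t<N)
  started-phase (loading S≤t t<N)    st = inj₁ (loading , S≤t , t<N)
  started-phase (critical S≤t t<N _) st = inj₁ (critical , S≤t , t<N)
  started-phase (finished t<S)       st = inj₂ (refl , t<S)

  active⇒started : ∀ {a} → Active (pos a) → Started a
  active⇒started {local 1F _ _ _} testing  ()
  active⇒started {local 2F _ _ _} loading  ()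
  active⇒started {local 3F _ _ _} critical ()

  -- Distribution of tickets among the started threads.

  record Tickets (N : ℕ) (ls : Fin n → Local) : Set where
    field
      below  : ∀ {k} → Started (ls k) → ticket# (ls k) < N
      unique : ∀ {k k′} → Started (ls k) → Started (ls k′) → ticket# (ls k) ≡ ticket# (ls k′) → k ≡ k′
      holder : ∀ {t} → t < N → ∃[ k ] Started (ls k) × ticket# (ls k) ≡ t
  open Tickets

  -- Pigeonhole: `holder` maps tickets to threads injectively, because the ticket can be read off
  -- its holder. This bounds all timestamps.
  tickets≤threads : ∀ {N ls} → Tickets N ls → N ≤ n
  tickets≤threads {N} {ls} T = injective⇒≤ {f = λ i → proj₁ (holder T (toℕ<n i))} λ {i} {i′} eq →
    toℕ-injective (trans (sym (proj₂ (proj₂ (holder T (toℕ<n i)))))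
      (trans (cong (ticket# ∘ ls) eq) (proj₂ (proj₂ (holder T (toℕ<n i′))))))

  -- What a step preserves when it hands out no ticket. The relation is symmetric: `below` and
  -- `unique` are pulled back along it, `holder` is pushed forward.
  data SameTicket : Local → Local → Set where
    unstarted : ∀ {a b} → pos a ≡ 0F → pos b ≡ 0F → SameTicket a b
    started   : ∀ {a b} → Started a → Started b → ticket# a ≡ ticket# b → SameTicket a b

  sameTicket-refl : ∀ {a} → SameTicket a a
  sameTicket-refl {a} with pos a Fin.≟ 0F
  ... | yes eq = unstarted eq eq
  ... | no neq = started neq neq refl

  sameTicket-to : ∀ {a b} → SameTicket a b → Started a → Started b × ticket# a ≡ ticket# b
  sameTicket-to (unstarted a0 _) a≢0  = contradiction a0 a≢0
  sameTicket-to (started _ b≢0 eq) _  = b≢0 , eq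

  sameTicket-sym : ∀ {a b} → SameTicket a b → SameTicket b a
  sameTicket-sym (unstarted a0 b0)     = unstarted b0 a0
  sameTicket-sym (started a≢0 b≢0 eq) = started b≢0 a≢0 (sym eq)

  tickets-same : ∀ {N ls ls′} → (∀ k → SameTicket (ls k) (ls′ k)) → Tickets N ls → Tickets N ls′
  tickets-same {N} {ls} {ls′} same T = record
    { below  = λ st → let st₀ , eq = back st in subst (_< N) (sym eq) (below T st₀)
    ; unique = λ st st′ eq →
        let st₀ , e = back st ; st₀′ , e′ = back st′
        in unique T st₀ st₀′ (trans (sym e) (trans eq e′))
    ; holder = λ t<N →
        let k , st , eq = holder T t<N ; st′ , eq′ = sameTicket-to (same k) st
        in k , st′ , trans (sym eq′) eq
    }
    where
    back : ∀ {k} → Started (ls′ k) → Started (ls k) × ticket# (ls′ k) ≡ ticket# (ls k)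
    back {k} = sameTicket-to (sameTicket-sym (same k))

  -- All earlier tickets are below `N`, so `N` is new; and `k` held none before, so no earlier
  -- ticket loses its holder.
  tickets-take : ∀ {N ls ls′} k → pos (ls k) ≡ 0F → Started (ls′ k) → ticket# (ls′ k) ≡ N →
    (∀ k′ → k′ ≢ k → ls′ k′ ≡ ls k′) → Tickets N ls → Tickets (suc N) ls′
  tickets-take {N} {ls} {ls′} k k-idle k-started k-ticket others T = record
    { below = below′ ; unique = unique′ ; holder = holder′ }
    where
    old : ∀ {k′} → k′ ≢ k → Started (ls′ k′) → Started (ls k′)
    old {k′} k′≢k st eq = st (trans (cong pos (others k′ k′≢k)) eq)

    old-below : ∀ {k′} → k′ ≢ k → Started (ls′ k′) → ticket# (ls′ k′) < N
    old-below {k′} k′≢k st =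
      subst (λ a → ticket# a < N) (sym (others k′ k′≢k)) (below T (old k′≢k st))

    below′ : ∀ {k′} → Started (ls′ k′) → ticket# (ls′ k′) < suc N
    below′ {k′} st with k′ Fin.≟ k
    ... | yes refl = s≤s (≤-reflexive k-ticket)
    ... | no k′≢k  = m≤n⇒m≤1+n (old-below k′≢k st)

    unique′ : ∀ {k₁ k₂} → Started (ls′ k₁) → Started (ls′ k₂) →
      ticket# (ls′ k₁) ≡ ticket# (ls′ k₂) → k₁ ≡ k₂
    unique′ {k₁} {k₂} st₁ st₂ eq with k₁ Fin.≟ k | k₂ Fin.≟ k
    ... | yes refl | yes refl = refl
    ... | yes refl | no k₂≢k  =
      contradiction (trans (sym eq) k-ticket) (<⇒≢ (old-below k₂≢k st₂))
    ... | no k₁≢k  | yes refl =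
      contradiction (trans eq k-ticket) (<⇒≢ (old-below k₁≢k st₁))
    ... | no k₁≢k  | no k₂≢k  =
      unique T (old k₁≢k st₁) (old k₂≢k st₂)
        (trans (sym (cong ticket# (others k₁ k₁≢k))) (trans eq (cong ticket# (others k₂ k₂≢k))))

    holder′ : ∀ {t} → t < suc N → ∃[ k′ ] Started (ls′ k′) × ticket# (ls′ k′) ≡ t
    holder′ t<1+N with m≤n⇒m<n∨m≡n (≤-pred t<1+N)
    ... | inj₂ refl = k , k-started , k-ticket
    ... | inj₁ t<N with holder T t<N
    ... | k′ , st , eq with k′ Fin.≟ k
    ... | yes refl = contradiction k-idle st
    ... | no k′≢k  =
      k′ , subst Started (sym (others k′ k′≢k)) st , trans (cong ticket# (others k′ k′≢k)) eq

  -- Preservation of the lock protocol.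

  record Protocol (N S : ℕ) (ls : Fin n → Local) : Set where
    field
      each    : ∀ k → Consistent N S (ls k)
      order   : S ≤ N
      tickets : Tickets N ls
  open Protocol

  phase-take : ∀ {N S a} → Phase N S a → Phase (suc N) S a
  phase-take idle                  = idle
  phase-take (testing S≤t t<N)     = testing S≤t (m≤n⇒m≤1+n t<N)
  phase-take (loading S≤t t<N)     = loading S≤t (m≤n⇒m≤1+n t<N)
  phase-take (critical S≤t t<N eq) = critical S≤t (m≤n⇒m≤1+n t<N) eq
  phase-take (finished t<S)        = finished t<S

  -- For the threads other than the releasing one: their active tickets are at least `S` and differ
  -- from it, hence are at least `suc S`.
  phase-release : ∀ {N S a} → (Started a → S ≢ ticket# a) → Phase N S a → Phase N (suc S) a
  phase-release ≢S idle                  = idle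
  phase-release ≢S (testing S≤t t<N)     = testing (≤∧≢⇒< S≤t (≢S λ ())) t<N
  phase-release ≢S (loading S≤t t<N)     = loading (≤∧≢⇒< S≤t (≢S λ ())) t<N
  phase-release ≢S (critical S≤t t<N eq) = critical (≤∧≢⇒< S≤t (≢S λ ())) t<N eq
  phase-release ≢S (finished t<S)        = finished (m≤n⇒m≤1+n t<S)

  refreshed-sameTicket : ∀ {a b} → Refreshed a b → SameTicket a b
  refreshed-sameTicket {local j _ _ _} (refreshed _) with j Fin.≟ 0F
  ... | yes eq = unstarted eq eq
  ... | no neq = started neq neq refl

  refreshed-consistent : ∀ {N S a b} → Refreshed a b → time b ≤ S → Consistent N S a → Consistent N S b
  refreshed-consistent (refreshed w≤w′) w′≤S (consistent ph u≤w _) =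
    consistent (phase′ ph) (≤-trans u≤w w≤w′) w′≤S
    where
    phase′ : ∀ {N S j t u w w′} → Phase N S (local j t u w) → Phase N S (local j t u w′)
    phase′ idle                  = idle
    phase′ (testing S≤t t<N)     = testing S≤t t<N
    phase′ (loading S≤t t<N)     = loading S≤t t<N
    phase′ (critical S≤t t<N eq) = critical S≤t t<N eq
    phase′ (finished t<S)        = finished t<S

  module _ {ls ls′ : Fin n → Local} (k : Fin n) (others : ∀ k′ → k′ ≢ k → ls′ k′ ≡ ls k′) where

    pointwise-consistent : ∀ {N S} → Consistent N S (ls′ k) →
      (∀ k′ → k′ ≢ k → Consistent N S (ls k′)) → ∀ k′ → Consistent N S (ls′ k′)
    pointwise-consistent {N} {S} mine elsewhere k′ with k′ Fin.≟ k
    ... | yes refl = mine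
    ... | no k′≢k  = subst (Consistent N S) (sym (others k′ k′≢k)) (elsewhere k′ k′≢k)

    pointwise-sameTicket : SameTicket (ls k) (ls′ k) → ∀ k′ → SameTicket (ls k′) (ls′ k′)
    pointwise-sameTicket mine k′ with k′ Fin.≟ k
    ... | yes refl = mine
    ... | no k′≢k  = subst (SameTicket (ls k′)) (sym (others k′ k′≢k)) sameTicket-refl

    protocol-local : ∀ {N S} → SameTicket (ls k) (ls′ k) → Consistent N S (ls′ k) →
      Protocol N S ls → Protocol N S ls′
    protocol-local same mine P = record
      { each    = pointwise-consistent mine (λ k′ _ → each P k′)
      ; order   = order P
      ; tickets = tickets-same (pointwise-sameTicket same) (tickets P)
      }

    protocol-moved : ∀ {N S N′ S′ a b} → ls k ≡ a → ls′ k ≡ b → Move N S a b N′ S′ →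
      Protocol N S ls → Protocol N′ S′ ls′
    -- Transport to the explicit `a`, where matching on the `Move` leaves a single possible phase.
    protocol-moved {N} {S} ka kb m P with subst (Consistent N S) ka (each P k)
    protocol-moved {N} {S} ka kb take P | consistent idle u≤w w≤S = record
      { each    = pointwise-consistent
          (subst (Consistent _ _) (sym kb) (consistent (testing (order P) ≤-refl) u≤w w≤S))
          (λ k′ _ → let consistent ph u≤w w≤S = each P k′ in consistent (phase-take ph) u≤w w≤S)
      ; order   = m≤n⇒m≤1+n (order P)
      ; tickets = tickets-take k (cong pos ka) (subst Started (sym kb) λ ()) (cong ticket# kb)
                    others (tickets P)
      }
    protocol-moved ka kb (enter _) P | consistent (testing S≤t t<N) u≤w w≤S =
      protocol-local (subst₂ SameTicket (sym ka) (sym kb) (started (λ ()) (λ ()) refl))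
        (subst (Consistent _ _) (sym kb) (consistent (loading S≤t t<N) u≤w w≤S)) P
    protocol-moved ka kb (leave u≡t) P | consistent (testing S≤t t<N) u≤w w≤S =
      protocol-local (subst₂ SameTicket (sym ka) (sym kb) (started (λ ()) (λ ()) refl))
        (subst (Consistent _ _) (sym kb) (consistent (critical S≤t t<N u≡t) u≤w w≤S)) P
    protocol-moved ka kb load P | consistent (loading S≤t t<N) u≤w w≤S =
      protocol-local (subst₂ SameTicket (sym ka) (sym kb) (started (λ ()) (λ ()) refl))
        (subst (Consistent _ _) (sym kb) (consistent (testing S≤t t<N) ≤-refl w≤S)) P
    protocol-moved {N} {S} ka kb (release {t}) P | consistent (critical S≤t t<N refl) u≤S _ = record
      { each    = pointwise-consistent
          (subst (Consistent _ _) (sym kb)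
            (consistent (finished (s≤s u≤S)) (m≤n⇒m≤1+n u≤S) ≤-refl))
          (λ k′ k′≢k → let consistent ph u≤w w≤S = each P k′ in
            consistent
              (phase-release (λ st S≡ → k′≢k (unique (tickets P) st k-started (trans (sym S≡) S≡ticket))) ph)
              u≤w (m≤n⇒m≤1+n w≤S))
      ; order   = ≤-trans (s≤s S≤t) t<N
      ; tickets = tickets-same
          (pointwise-sameTicket (subst₂ SameTicket (sym ka) (sym kb) (started (λ ()) (λ ()) refl)))
          (tickets P)
      }
      where
      k-started : Started (ls k)
      k-started = subst Started (sym ka) λ ()

      -- In the critical section the ticket is also the value last seen, so it is at most `time`,
      -- which is `S` here.
      S≡ticket : S ≡ ticket# (ls k)
      S≡ticket = trans (≤-antisym S≤t u≤S) (sym (cong ticket# ka))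

  -- The inductive invariant along runs and the bound on views.

  record Invariant (N S : ℕ) (σ : State) : Set where
    constructor invariant
    field
      wellFormed : WellFormed (proj₁ σ)
      coherent   : Coherent (proj₂ σ) (Bounds N S)
      protocol   : Protocol N S (localOf σ)
  open Invariant

  Inv : State → Set
  Inv σ = ∃[ N ] ∃[ S ] Invariant N S σ

  change-protocol : ∀ {N S σ a σ′ N′ S′} → Change N S σ a σ′ N′ S′ →
    Coherent (proj₂ σ′) (Bounds N′ S′) →
    Protocol N S (localOf σ) → Protocol N′ S′ (localOf σ′)
  change-protocol (moved {k} m others) C P = protocol-moved k others refl refl m P
  change-protocol (propagated refresh) C P = record
    { each    = λ k → refreshed-consistent (refresh k) (view≤ C (suc k) srv) (each P k)
    ; order   = order P
    ; tickets = tickets-same (λ k → refreshed-sameTicket (refresh k)) (tickets P)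
    }

  inv-step : ∀ {σ a σ′} → Inv σ → CombinedStep σ a σ′ → Inv σ′
  inv-step (_ , _ , invariant wf C P) st with combined-step wf C st
  ... | mkStep wf′ C′ ch = _ , _ , invariant wf′ C′ (change-protocol ch C′ P)

  inv-initial : Inv (initProg ticket , initMem)
  inv-initial = 0 , 0 , invariant wf initMem-coherent record
    { each = λ k → subst (Consistent 0 0) (sym (initial k)) (consistent idle z≤n z≤n)
    ; order = z≤n
    ; tickets = record
      { below = λ {k} st → contradiction (cong pos (initial k)) st
      ; unique = λ {k} st → contradiction (cong pos (initial k)) st
      ; holder = λ ()
      }
    }
    where
    initial-pc : ∀ k → lookup (pc (initProg ticket)) (suc k) ≡ l k 0F
    initial-pc k = trans (lookup-map k firstPos (tabulate thread))
                         (cong firstPos (lookup∘tabulate thread k))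

    wf : WellFormed (initProg ticket)
    wf = record { code₀ = refl ; pc₀ = refl
                ; thread-at = λ k → 0F , lookup∘tabulate thread k , initial-pc k }

    initial : ∀ k → localOf (initProg ticket , initMem) k ≡ local 0F 0 0 0
    initial k = local-cong (cong proj₂ (initial-pc k))
      (lookup-replicate (nxt k) 0) (lookup-replicate (s k) 0)
      (cong (λ V → lookup V srv) (lookup-replicate k V₀))

  inv-run : (r : Run (ticket ∥StrCOH)) → ∀ i → Inv (Run.state r i)
  inv-run r zero    = subst Inv (sym (Run.start r)) inv-initial
  inv-run r (suc i) = kept (inv-run r i) (Run.next r i)
    where
    kept : ∀ {σ α σ′} → Inv σ → Transition (ticket ∥StrCOH) σ α σ′ → Inv σ′
    kept I (step a) = inv-step I a
    kept I (idle _) = I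

  -- There are `suc n` views, that of `T₀` included, each with the two entries `next` and `srv`;
  -- both are at most `n` because `S ≤ N ≤ n`.
  total-bounded : ∀ {σ} → Inv σ → total (proj₂ σ) ≤ suc n * (2 * n)
  total-bounded {_ , q} (N , S , invariant _ C P) =
    lookup≤⇒sum≤ (Vec.map sum (ν q)) λ τ →
      subst (_≤ 2 * n) (sym (lookup-map τ sum (ν q)))
        (lookup≤⇒sum≤ (lookup (ν q) τ) λ x → ≤-trans (view≤ C τ x) (bounds x))
    where
    bounds : ∀ x → lookup (Bounds N S) x ≤ n
    bounds 0F = tickets≤threads (tickets P)
    bounds 1F = ≤-trans (order P) (tickets≤threads (tickets P))

  total-step : ∀ {σ a σ′} → CombinedStep σ a σ′ → total (proj₂ σ) ≤ total (proj₂ σ′)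
  total-step (joint _ ms)  = mem-total ms
  total-step (silent _)    = ≤-refl
  total-step (internal ps) = <⇒≤ (prop-total ps)

  total-prop : ∀ {σ σ′} → CombinedStep σ prop σ′ → total (proj₂ σ) < total (proj₂ σ′)
  total-prop (internal ps) = prop-total ps

  hasMessage-step : ∀ {σ a σ′ x t} → CombinedStep σ a σ′ →
    HasMessage x t (proj₂ σ) → HasMessage x t (proj₂ σ′)
  hasMessage-step (joint _ ms) (v , τ , V , m∈) = v , τ , V , mem-keeps ms m∈
  hasMessage-step (silent _)   h = h
  hasMessage-step (internal (propagate _ _ _)) h = h

  -- Steps from the viewpoint of one thread.

  data LocalChange (k : Fin n) (σ : State) : Action → State → Set where
    own : ∀ {ℓ σ′ N S N′ S′} →
      Consistent N S (localOf σ k) →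
      Move N S (localOf σ k) (localOf σ′ k) N′ S′ →
      LocalChange k σ (cmd (suc k) ℓ (l k (pos (localOf σ k)))) σ′
    foreign : ∀ {a σ′} →
      (∀ {τ ℓ j} → a ≢ cmd τ ℓ (l k j)) →
      Refreshed (localOf σ k) (localOf σ′ k) →
      LocalChange k σ a σ′

  -- The just set recognises a command by its position, whichever thread executes it. Positions
  -- contain the index of their thread, so a step of another thread never counts as a command of
  -- `k`, as `foreign` records.
  local-change : ∀ {σ a σ′} k → Inv σ → CombinedStep σ a σ′ → LocalChange k σ a σ′
  local-change k (_ , _ , invariant wf C P) st with combined-step wf C st
  ... | mkStep _ _ (propagated refresh) = foreign (λ ()) (refresh k)
  ... | mkStep _ _ (moved {k′} m others) with k Fin.≟ k′
  ... | yes refl = own (each P k) m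
  ... | no k≢k′  = foreign (λ { refl → k≢k′ refl })
                           (subst (Refreshed _) (sym (others k k≢k′)) refreshed-refl)

  inv-pc : ∀ {σ} → Inv σ → ∀ k → lookup (pc (proj₁ σ)) (suc k) ≡ l k (pos (localOf σ k))
  inv-pc (_ , _ , invariant wf _ _) k with thread-at wf k
  ... | j , _ , pc≡ = trans pc≡ (cong (l k) (sym (cong proj₂ pc≡)))

  inv-at : ∀ {σ} → Inv σ → ∀ k {j} → at (l k j) σ → pos (localOf σ k) ≡ j
  inv-at (_ , _ , invariant wf _ _) k (zero , eq) with trans (sym (pc₀ wf)) (cong proj₁ eq)
  ... | ()
  inv-at I k (suc k′ , eq) with trans (sym (inv-pc I k′)) eq
  ... | refl = refl

  command-position : ∀ k {j} → j ≢ 4F → l k j ∈ commandPositions (body (lookup ticket (suc k)))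
  command-position k {j} j≢4 =
    subst (λ c → l k j ∈ commandPositions (body c)) (sym (lookup∘tabulate thread k)) (in-thread j j≢4)
    where
    in-thread : ∀ j → j ≢ 4F → l k j ∈ commandPositions (body (thread k))
    in-thread 0F _ = here refl
    in-thread 1F _ = there (here refl)
    in-thread 2F _ = there (there (here refl))
    in-thread 3F _ = there (there (there (here refl)))
    in-thread 4F 4≢4 = contradiction refl 4≢4

  Holding : ℕ → Local → Set
  Holding v a = Started a × ticket# a ≡ v

  -- Only `take` writes the ticket register, and it starts at `0F`, to which a started thread never
  -- returns.
  holding-step : ∀ {σ a σ′ v} k → Inv σ → Holding v (localOf σ k) → CombinedStep σ a σ′ →
    Holding v (localOf σ′ k)
  holding-step {v = v} k I h st with local-change k I st
  ... | foreign _ refresh = after-refresh refresh h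
    where
    after-refresh : ∀ {a b} → Refreshed a b → Holding v a → Holding v b
    after-refresh (refreshed _) h = h
  ... | own _ m = after-move m h
    where
    after-move : ∀ {N S a b N′ S′} → Move N S a b N′ S′ → Holding v a → Holding v b
    after-move take      (st , _) = contradiction refl st
    after-move (enter _) (_ , eq) = (λ ()) , eq
    after-move (leave _) (_ , eq) = (λ ()) , eq
    after-move load      (_ , eq) = (λ ()) , eq
    after-move release   (_ , eq) = (λ ()) , eq

  -- An inequality, so that it survives later propagations; for an active thread the invariant
  -- `time ≤ S ≤ ticket#` turns it into an equality.
  Notified : ℕ → Local → Set
  Notified v a = ticket# a ≡ v × v ≤ time a

  AtPos : Fin 5 → Local → Set
  AtPos j a = pos a ≡ j

  NotifiedAt : ℕ → Fin 5 → Local → Set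
  NotifiedAt v j a = pos a ≡ j × Notified v a

  Admitted : Local → Set
  Admitted a = pos a ≡ 1F × seen a ≡ ticket# a

  infix 5 _for_
  _for_ : (Local → Set) → Fin n → State → Set
  (P for k) σ = P (localOf σ k)

  -- Liveness of the lock.

  module Liveness (em : ExcludedMiddle 0ℓ)
    (r : Run (ticket ∥StrCOH)) (fair : Fair (ticket ∥StrCOH) (commands+prop ticket) r) where
    open LeadsTo em {J = commands+prop ticket} r fair Inv (inv-run r)
    open Run r using (state)

    -- `P` fixes the position, so the command there stays enabled until `k` itself moves; every
    -- other step acts on `k` as a refresh. Response properties thus reduce to a case check on
    -- `Move`.
    local-ensures : ∀ {P Q : Local → Set} k {j} → j ≢ 4F →
      (∀ {a} → P a → pos a ≡ j) →
      (∀ {a b} → Refreshed a b → P a → P b) →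
      (∀ {N S a b N′ S′} → Consistent N S a → Move N S a b N′ S′ → P a → Q b) →
      P for k ↝ Q for k
    local-ensures {P} {Q} k {j} j≢4 at-j refresh move =
      ensures (command (suc k) (l k j) (command-position k j≢4)) enabled unless takes
      where
      enabled : ∀ {σ} → Inv σ → P (localOf σ k) → lookup (pc (proj₁ σ)) (suc k) ≡ l k j
      enabled I p = trans (inv-pc I k) (cong (l k) (at-j p))

      unless : ∀ {σ a σ′} → Inv σ → P (localOf σ k) → CombinedStep σ a σ′ →
        P (localOf σ′ k) ⊎ Q (localOf σ′ k)
      unless I p st with local-change k I st
      ... | own c m       = inj₂ (move c m p)
      ... | foreign _ ref = inj₁ (refresh ref p)

      takes : ∀ {σ a σ′} → Inv σ → P (localOf σ k) → CombinedStep σ a σ′ →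
        ∃[ τ ] ∃[ ℓ ] a ≡ cmd τ ℓ (l k j) → Q (localOf σ′ k)
      takes I p st (_ , _ , eq) with local-change k I st
      ... | own c m      = move c m p
      ... | foreign a≢ _ = contradiction eq a≢

    takes-ticket : ∀ k → AtPos 0F for k ↝ AtPos 1F for k
    takes-ticket k = local-ensures {AtPos 0F} {AtPos 1F} k (λ ()) id (λ { (refreshed _) eq → eq })
      λ { _ take _ → refl ; _ (enter _) () ; _ (leave _) () ; _ load () ; _ release () }

    exits : ∀ k → AtPos 3F for k ↝ AtPos 4F for k
    exits k = local-ensures {AtPos 3F} {AtPos 4F} k (λ ()) id (λ { (refreshed _) eq → eq })
      λ { _ release _ → refl ; _ take () ; _ (enter _) () ; _ (leave _) () ; _ load () }

    leaves-loop : ∀ k → Admitted for k ↝ AtPos 3F for k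
    leaves-loop k = local-ensures {Admitted} {AtPos 3F} k (λ ()) proj₁ (λ { (refreshed _) p → p })
      λ { _ (leave _) _ → refl ; _ (enter u≢t) (_ , u≡t) → contradiction u≡t u≢t
        ; _ take (() , _) ; _ load (() , _) ; _ release (() , _) }

    notifiedAt-refreshed : ∀ {v j a b} → Refreshed a b → NotifiedAt v j a → NotifiedAt v j b
    notifiedAt-refreshed (refreshed w≤w′) (p , t≡v , v≤w) = p , t≡v , ≤-trans v≤w w≤w′

    -- The load returns `time`, and `v ≤ time ≤ S ≤ ticket# = v` forces it to be the ticket.
    loads-ticket : ∀ v k → NotifiedAt v 2F for k ↝ Admitted for k
    loads-ticket v k = local-ensures {NotifiedAt v 2F} {Admitted} k (λ ()) proj₁ notifiedAt-refreshed
      λ { (consistent (loading S≤t _) _ w≤S) load (_ , refl , v≤w) →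
            refl , ≤-antisym (≤-trans w≤S S≤t) v≤w
        ; _ take (() , _) ; _ (enter _) (() , _) ; _ (leave _) (() , _) ; _ release (() , _) }

    -- Both branches are possible: the register may still hold a value older than the view.
    tests : ∀ v k → NotifiedAt v 1F for k ↝ (λ a → NotifiedAt v 2F a ⊎ AtPos 3F a) for k
    tests v k = local-ensures {NotifiedAt v 1F} {λ a → NotifiedAt v 2F a ⊎ AtPos 3F a}
      k (λ ()) proj₁ notifiedAt-refreshed
      λ { _ (enter _) (_ , nd) → inj₁ (refl , nd) ; _ (leave _) _ → inj₂ refl
        ; _ take (() , _) ; _ load (() , _) ; _ release (() , _) }

    -- At most one more load is needed, since it returns the ticket and the next test then leaves
    -- the loop.
    notified-finishes : ∀ v k → (λ a → Active (pos a) × Notified v a) for k ↝ AtPos 4F for k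
    notified-finishes v k =
      ↝-trans
        (↝-refl {Q = (λ a → NotifiedAt v 1F a ⊎ NotifiedAt v 2F a ⊎ AtPos 3F a) for k} (uncurry cases))
        (↝-case (↝-trans (tests v k) from-2-or-3) from-2-or-3)
      where
      from-2-or-3 : (λ a → NotifiedAt v 2F a ⊎ AtPos 3F a) for k ↝ AtPos 4F for k
      from-2-or-3 = ↝-case
        (↝-trans {NotifiedAt v 2F for k} (loads-ticket v k) (↝-trans (leaves-loop k) (exits k)))
        (exits k)

      cases : ∀ {j A} → Active j → A → (j ≡ 1F × A) ⊎ (j ≡ 2F × A) ⊎ j ≡ 3F
      cases testing  a = inj₁ (refl , a)
      cases loading  a = inj₂ (inj₁ (refl , a))
      cases critical a = inj₂ (inj₂ refl)

    -- The message of timestamp `v` is what a propagation can deliver to the holder. Both conjuncts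
    -- are stable, so only a raised view of `srv` can end the need for it.
    Called : ℕ → Fin n → State → Set
    Called v k σ = Holding v (localOf σ k) × HasMessage srv v (proj₂ σ)

    called-step : ∀ {σ a σ′ v} k → Inv σ → Called v k σ → CombinedStep σ a σ′ → Called v k σ′
    called-step k I (h , msg) st = holding-step k I h st , hasMessage-step st msg

    -- Although prop is a single member of the just set, serving all threads and
    -- locations at once, it is taken only boundedly often, since every propagation
    -- increases the sum of all views.
    notified : ∀ v k → Called v k ↝
      (λ σ → ((λ a → Active (pos a) × Notified v a) for k) σ ⊎ (AtPos 4F for k) σ)
    notified v k =
      ↝-trans split (↝-case (↝-refl id) (climb (total ∘ proj₂) (suc n * (2 * n)) total-bounded raise))
      where
      Goal Lagging : State → Set
      Goal σ = (Active (pos (localOf σ k)) × Notified v (localOf σ k)) ⊎ pos (localOf σ k) ≡ 4F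
      Lagging σ = Called v k σ × time (localOf σ k) < v

      classify : ∀ {σ} → Inv σ → Called v k σ → Goal σ ⊎ Lagging σ
      classify {σ} (_ , _ , invariant _ _ P) c@((st , t≡v) , _)
        with v ≤? time (localOf σ k) | started-phase (phase (each P k)) st
      ... | yes v≤w | inj₁ (active , _) = inj₁ (inj₁ (active , t≡v , v≤w))
      ... | yes v≤w | inj₂ (done , _)   = inj₁ (inj₂ done)
      ... | no v≰w  | _                 = inj₂ (c , ≰⇒> v≰w)

      split : Called v k ↝ (λ σ → Goal σ ⊎ Lagging σ)
      split .eventually i c = i , ≤-refl , classify (inv-run r i) c

      raise : ∀ m → (λ σ → Lagging σ × m ≤ total (proj₂ σ)) ↝
                    (λ σ → Goal σ ⊎ (Lagging σ × m < total (proj₂ σ)))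
      raise m = ensures prop enabled unless takes
        where
        enabled : ∀ {σ} → Inv σ → Lagging σ × m ≤ total (proj₂ σ) →
          ∃[ σ′ ] CombinedStep σ prop σ′
        -- Delivering `v` to `k` witnesses enabledness, but fairness may take any other propagation;
        -- hence progress is measured by `total`.
        enabled _ (((_ , _ , _ , _ , m∈) , lag) , _) = _ , internal (propagate (suc k) m∈ lag)

        unless : ∀ {σ a σ′} → Inv σ → Lagging σ × m ≤ total (proj₂ σ) → CombinedStep σ a σ′ →
          (Lagging σ′ × m ≤ total (proj₂ σ′)) ⊎ (Goal σ′ ⊎ (Lagging σ′ × m < total (proj₂ σ′)))
        unless I ((c , _) , m≤) st with classify (inv-step I st) (called-step k I c st)
        ... | inj₁ goal = inj₂ (inj₁ goal)
        ... | inj₂ lag  = inj₁ (lag , ≤-trans m≤ (total-step st))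

        takes : ∀ {σ a σ′} → Inv σ → Lagging σ × m ≤ total (proj₂ σ) → CombinedStep σ a σ′ →
          a ≡ prop → Goal σ′ ⊎ (Lagging σ′ × m < total (proj₂ σ′))
        takes I ((c , _) , m≤) st refl with classify (inv-step I st) (called-step k I c st)
        ... | inj₁ goal = inj₁ goal
        ... | inj₂ lag  = inj₂ (lag , ≤-<-trans m≤ (total-prop st))

    called-finishes : ∀ v k → Called v k ↝ AtPos 4F for k
    called-finishes v k = ↝-trans (notified v k) (↝-case (notified-finishes v k) (↝-refl id))

    open ≤-Reasoning

    -- d bounds the number of tickets to be served before that of k.
    holder-finishes : ∀ d {N S} k i → Invariant N S (state i) → Started (localOf (state i) k) →
      ticket# (localOf (state i) k) ≤ d + S →
      ∃[ j ] i ≤ j × pos (localOf (state j) k) ≡ 4F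
    holder-finishes d k i (invariant wf C P) st t≤d+S
      with started-phase (phase (each P k)) st
    ... | inj₂ (done , _) = i , ≤-refl , done
    ... | inj₁ (_ , S≤t , t<N) with m≤n⇒m<n∨m≡n S≤t
    ... | inj₂ S≡t =
      -- The turn of `k` has come: its ticket is `S`, and `full` supplies the message that announces
      -- it.
      eventually (called-finishes _ k) i ((st , refl) , full C srv (≤-reflexive (sym S≡t)))
    holder-finishes zero k i _ st t≤S | inj₁ _ | inj₁ S<t = contradiction t≤S (<⇒≱ S<t)
    holder-finishes (suc d) {S = S} k i (invariant wf C P) st t≤d+S | inj₁ (_ , S≤t , t<N) | inj₁ S<t
      -- First let the holder `k₀` of ticket `S` finish. Its ticket then lies below the new `S′`, so
      -- `S < S′` and the distance left for `k` is at most `d`.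
      with k₀ , st₀ , t₀≡S ← holder (tickets P) (<-trans S<t t<N)
      with i′ , i≤i′ , done ← eventually (called-finishes S k₀) i ((st₀ , t₀≡S) , full C srv ≤-refl)
      with N′ , S′ , I′@(invariant _ _ P′) ← inv-run r i′
      with st₀′ , t₀′≡S ← stable {P = λ σ → Holding S (localOf σ k₀)} (holding-step k₀) i≤i′ (st₀ , t₀≡S)
      with st′ , t′≡t ← stable {P = λ σ → Holding (ticket# (localOf (state i) k)) (localOf σ k)}
                          (holding-step k) i≤i′ (st , refl)
      with started-phase (phase (each P′ k₀)) st₀′
    ... | inj₁ (active , _) = contradiction (subst Active done active) λ ()
    ... | inj₂ (_ , t₀<S′)
      with j , i′≤j , fin ← holder-finishes d k i′ I′ st′ (begin
             ticket# (localOf (state i′) k) ≡⟨ t′≡t ⟩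
             ticket# (localOf (state i) k)  ≤⟨ t≤d+S ⟩
             suc d + S                      ≡⟨ +-suc d S ⟨
             d + suc S                      ≤⟨ +-monoʳ-≤ d (subst (_< S′) t₀′≡S t₀<S′) ⟩
             d + S′                         ∎) =
      j , ≤-trans i≤i′ i′≤j , fin

    starvation-free : ∀ k i → at (l k 0F) (state i) → ∃[ j ] i ≤ j × at (l k 4F) (state j)
    starvation-free k i at-0
      with i′ , i≤i′ , pos≡1 ← eventually (takes-ticket k) i (inv-at (inv-run r i) k at-0)
      with N , S , I ← inv-run r i′
      -- The ticket itself serves as the initial distance, being at most its sum with `S`.
      with j , i′≤j , pos≡4 ← holder-finishes (ticket# (localOf (state i′) k)) k i′ I
             (λ pos≡0 → contradiction (trans (sym pos≡1) pos≡0) λ ()) (m≤m+n _ S) =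
      j , ≤-trans i≤i′ i′≤j , suc k , trans (inv-pc (inv-run r j) k) (cong (l k) pos≡4)

mainTheorem4 : ExcludedMiddle 0ℓ →
    ∀ (n : ℕ) → 1 ≤ n → ∀ (k : Fin n) →
    let open Ticket n in
    FairlySatisfies□[_⇒◇_] (ticket ∥StrCOH) (commands+prop ticket)
    (at (l k 0F)) (at (l k 4F))
mainTheorem4 em n _ k r fair = TicketLock.Liveness.starvation-free n em r fair k
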